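{- There exists an infinite family of connected $3$-valent $2$-arc-transitive graphs $\{\Lambda_n\}_{n\in\mathbb{N}}$ such that the $1$-eigenspace of $\Lambda_n$ over $\mathbb{F}_2$ has dimension at least $|\mathrm{V}(\Lambda_n)|/72$.
   Context: Graphs are finite, simple and undirected. A $2$-arc of a graph is a sequence $(u,v,w)$ of vertices with $u\sim v\sim w$ and $u\ne w$; a graph is $2$-arc-transitive if its automorphism group acts transitively on its $2$-arcs. The $1$-eigenspace of a graph $\Lambda$ over $\mathbb{F}_2$ is the eigenspace for eigenvalue $1$ of its adjacency matrix regarded as a matrix over the field $\mathbb{F}_2$ of order $2$, i.e. the set of $x\in\mathbb{F}_2^{\mathrm{V}(\Lambda)}$ with $\sum_{u\sim v}x(u)=x(v)$ for every vertex $v$. -}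

module Defs where

open import Data.Nat using (ℕ; zero; suc; _+_; _*_; _≤_; _<_)
open import Data.Bool using (Bool; true; false; _∧_; _xor_; if_then_else_)
open import Data.Fin using (Fin)
open import Data.List using (List; map; foldr; allFin)
open import Data.Nat.ListAction using (sum)
open import Data.Product using (Σ; ∃; _×_; _,_)
open import Relation.Binary.PropositionalEquality using (_≡_)
open import Relation.Nullary using (¬_)
open import Data.Fin.Permutation using (Permutation′; _⟨$⟩ʳ_)

record Graph (n : ℕ) : Set where
  field
    adj    : Fin n → Fin n → Bool
    adj-sym    : ∀ u v → adj u v ≡ adj v u
    adj-irrefl : ∀ v → adj v v ≡ false

open Graph public

module _ {n : ℕ} (G : Graph n) where

  Adj : Fin n → Fin n → Set
  Adj u v = adj G u v ≡ true

  degree : Fin n → ℕ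
  degree v = sum (map (λ u → if adj G v u then 1 else 0) (allFin n))

  Cubic : Set
  Cubic = ∀ v → degree v ≡ 3

  data Reach (u : Fin n) : Fin n → Set where
    here : Reach u u
    step : ∀ {v w} → Reach u v → Adj v w → Reach u w

  Connected : Set
  Connected = 0 < n × (∀ u v → Reach u v)

  IsAutomorphism : Permutation′ n → Set
  IsAutomorphism σ = ∀ u v → adj G (σ ⟨$⟩ʳ u) (σ ⟨$⟩ʳ v) ≡ adj G u v

  Is2Arc : Fin n → Fin n → Fin n → Set
  Is2Arc u v w = Adj u v × Adj v w × ¬ (u ≡ w)

  TwoArcTransitive : Set
  TwoArcTransitive =
    ∀ u v w u′ v′ w′ → Is2Arc u v w → Is2Arc u′ v′ w′ →
    Σ (Permutation′ n) λ σ → IsAutomorphism σ ×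
      ((σ ⟨$⟩ʳ u) ≡ u′ × (σ ⟨$⟩ʳ v) ≡ v′ × (σ ⟨$⟩ʳ w) ≡ w′)

-- vectors over F₂ = Bool (addition xor, multiplication ∧)
F2Vec : ℕ → Set
F2Vec n = Fin n → Bool

sumF2 : List Bool → Bool
sumF2 = foldr _xor_ false

module _ {n : ℕ} (G : Graph n) where

  In1Eigenspace : F2Vec n → Set
  In1Eigenspace x = ∀ v → sumF2 (map (λ u → adj G v u ∧ x u) (allFin n)) ≡ x v

linComb : ∀ {n d} → (Fin d → F2Vec n) → (Fin d → Bool) → F2Vec n
linComb {d = d} b c u = sumF2 (map (λ i → c i ∧ b i u) (allFin d))

LinIndep : ∀ {n d} → (Fin d → F2Vec n) → Set
LinIndep {n} {d} b = ∀ c → (∀ u → linComb b c u ≡ false) → ∀ i → c i ≡ false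

EigDimAtLeast : ∀ {n} → Graph n → ℕ → Set
EigDimAtLeast {n} G d =
  Σ (Fin d → F2Vec n) λ b → (∀ i → In1Eigenspace G (b i)) × LinIndep b

{-# OPTIONS --safe #-}

-- Let ζ be a primitive 8th root of unity. The graphs are the covers of the Möbius–Kantor graph G(8,3)
-- with group ℤ[ζ]/m obtained from the voltage ζⁱ on the arc from the inner vertex i to the inner vertex
-- i+3 and 0 on the outer edges and the spokes. A reflection, an edge flip and an exotic involution of
-- G(8,3) lift to the infinite cover with group ℤ[ζ]; the first and the third generate S₃ on the
-- neighbours of a fixed vertex, so by connectedness the covers are 2-arc-transitive. The infinite cover
-- has an 80-element vertex set that meets every closed neighbourhood evenly, and its translates give
-- 1-eigenvectors of the finite covers. For even m, a quarter of the m⁴ translates are independent, since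
-- each of them contains a vertex lying in no other one; this gives dimension at least |V|/64.
module Submission where

open import Defs
open import Data.Nat using (ℕ; _*_; _≤_; _<_)
open import Data.Product using (Σ; ∃; _×_)

open import Algebra.Structures using (IsCommutativeMonoid)
open import Algebra.Bundles using (CommutativeRing)
open import Data.Bool using (Bool; true; false; _∧_; _∨_; _xor_; if_then_else_)
open import Data.Bool.Properties using (xor-∧-commutativeRing; xor-assoc; xor-comm; xor-identityʳ; xor-same; ∧-identityʳ; ∧-zeroʳ; ∨-zeroʳ)
open import Data.Fin using (Fin; zero; suc; toℕ; fromℕ<)
open import Data.Fin.Patterns using (0F; 1F; 2F; 3F; 4F; 5F; 6F; 7F)
open import Data.Fin.Permutation as Perm using (Permutation′; _⟨$⟩ʳ_; _⟨$⟩ˡ_; _∘ₚ_; flip; permutation; inverseˡ; inverseʳ)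
open import Data.Fin.Properties using (_≟_; all?; any?; toℕ-fromℕ<; toℕ-injective; toℕ<n; *↔×)
open import Data.Integer as ℤ using (ℤ; +_; 0ℤ; 1ℤ; -1ℤ)
open import Data.Integer.DivMod using (_%ℕ_; _/ℕ_; n%ℕd<d; a≡a%ℕn+[a/ℕn]*n)
import Data.Integer.Properties as ℤ
open import Data.Integer.Divisibility.Signed using (_∣_; divides; _∣?_)
open import Data.Integer.Tactic.RingSolver using (solve-∀)
open import Data.List using (List; []; _∷_; _++_; map; foldr; allFin; drop; replicate; iterate; concat; concatMap)
open import Data.List.Relation.Unary.All as All using (All; []; _∷_)
open import Data.List.Properties using (map-cong; map-tabulate)
import Data.Nat as ℕ
open import Data.Nat.DivMod using (_mod_; m<n⇒m%n≡m)
open import Data.Nat.GeneralisedArithmetic using (fold)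
import Data.Nat.Properties as ℕ
open import Data.Nat.Tactic.RingSolver using () renaming (solve-∀ to ℕ-solve-∀)
open import Data.Product using (_,_; proj₁; proj₂)
open import Data.Product.Properties using (≡-dec)
open import Data.Product.Function.NonDependent.Propositional using (_×-↔_)
open import Function using (_∘_; id; _↔_; mk⇔)
open import Function.Bundles using (Inverse)
open import Function.Construct.Composition using (_↔-∘_)
open import Function.Construct.Identity using (↔-id)
open import Relation.Binary.PropositionalEquality
open import Relation.Nullary using (¬_; Dec; yes; no; does; contradiction; ¬?)
open import Relation.Nullary.Decidable using (_×-dec_; _→-dec_; dec-true; dec-false; does-⇔; from-yes; map′)

-- Finite sums in a commutative monoid.

module FiniteSum {A : Set} {_∙_ : A → A → A} {ε : A}
                 (isCommutativeMonoid : IsCommutativeMonoid _≡_ _∙_ ε) where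

  open IsCommutativeMonoid isCommutativeMonoid
    using (assoc; comm; identityˡ; identityʳ)
  open ≡-Reasoning

  ∑ : ∀ {n} → (Fin n → A) → A
  ∑ {n} f = foldr _∙_ ε (map f (allFin n))

  ∑-suc : ∀ {n} (f : Fin (ℕ.suc n) → A) → ∑ f ≡ f zero ∙ ∑ (f ∘ suc)
  ∑-suc f = cong (λ xs → f zero ∙ foldr _∙_ ε xs)
    (trans (map-tabulate suc f) (sym (map-tabulate id (f ∘ suc))))

  ∑-cong : ∀ {n} {f g : Fin n → A} → (∀ i → f i ≡ g i) → ∑ f ≡ ∑ g
  ∑-cong {ℕ.zero}          eq = refl
  ∑-cong {ℕ.suc n} {f} {g} eq = begin
    ∑ f                  ≡⟨ ∑-suc f ⟩
    f zero ∙ ∑ (f ∘ suc) ≡⟨ cong₂ _∙_ (eq zero) (∑-cong (eq ∘ suc)) ⟩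
    g zero ∙ ∑ (g ∘ suc) ≡⟨ ∑-suc g ⟨
    ∑ g                  ∎

  interchange : ∀ a b c d → (a ∙ b) ∙ (c ∙ d) ≡ (a ∙ c) ∙ (b ∙ d)
  interchange a b c d = begin
    (a ∙ b) ∙ (c ∙ d) ≡⟨ assoc a b (c ∙ d) ⟩
    a ∙ (b ∙ (c ∙ d)) ≡⟨ cong (a ∙_) (assoc b c d) ⟨
    a ∙ ((b ∙ c) ∙ d) ≡⟨ cong (λ x → a ∙ (x ∙ d)) (comm b c) ⟩
    a ∙ ((c ∙ b) ∙ d) ≡⟨ cong (a ∙_) (assoc c b d) ⟩
    a ∙ (c ∙ (b ∙ d)) ≡⟨ assoc a c (b ∙ d) ⟨
    (a ∙ c) ∙ (b ∙ d) ∎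

  ∑-∙ : ∀ {n} (f g : Fin n → A) → ∑ (λ i → f i ∙ g i) ≡ ∑ f ∙ ∑ g
  ∑-∙ {ℕ.zero}  f g = sym (identityˡ ε)
  ∑-∙ {ℕ.suc n} f g = begin
    ∑ (λ i → f i ∙ g i)
      ≡⟨ ∑-suc (λ i → f i ∙ g i) ⟩
    (f zero ∙ g zero) ∙ ∑ (λ i → f (suc i) ∙ g (suc i))
      ≡⟨ cong ((f zero ∙ g zero) ∙_) (∑-∙ (f ∘ suc) (g ∘ suc)) ⟩
    (f zero ∙ g zero) ∙ (∑ (f ∘ suc) ∙ ∑ (g ∘ suc))
      ≡⟨ interchange (f zero) (g zero) _ _ ⟩
    (f zero ∙ ∑ (f ∘ suc)) ∙ (g zero ∙ ∑ (g ∘ suc))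
      ≡⟨ cong₂ _∙_ (∑-suc f) (∑-suc g) ⟨
    ∑ f ∙ ∑ g
      ∎

  ∑-ε : ∀ {n} {f : Fin n → A} → (∀ i → f i ≡ ε) → ∑ f ≡ ε
  ∑-ε {ℕ.zero}      eq = refl
  ∑-ε {ℕ.suc n} {f} eq =
    trans (∑-suc f) (trans (cong₂ _∙_ (eq zero) (∑-ε (eq ∘ suc))) (identityˡ ε))

  ∑-single : ∀ {n} {f : Fin n → A} (w : Fin n) →
             (∀ i → i ≢ w → f i ≡ ε) → ∑ f ≡ f w
  ∑-single {f = f} zero eq = trans (∑-suc f)
    (trans (cong (f zero ∙_) (∑-ε (λ i → eq (suc i) λ ()))) (identityʳ _))
  ∑-single {f = f} (suc w) eq = trans (∑-suc f)
    (trans (cong₂ _∙_ (eq zero λ ()) (∑-single w λ i i≢w → eq (suc i) λ { refl → i≢w refl }))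
           (identityˡ _))

  module _ {n} (x : Fin n → A) where

    pick : Fin n → Fin n → A
    pick w i = if does (w ≟ i) then x i else ε

    ∑-pick : ∀ w → ∑ (pick w) ≡ x w
    ∑-pick w = trans (∑-single w off) at
      where
      off : ∀ i → i ≢ w → pick w i ≡ ε
      off i i≢w with w ≟ i
      ... | yes w≡i = contradiction (sym w≡i) i≢w
      ... | no  _   = refl
      at : pick w w ≡ x w
      at with w ≟ w
      ... | yes _   = refl
      ... | no  w≢w = contradiction refl w≢w

    -- Distinctness makes the three indicators disjoint, so the disjunction splits into a sum of
    -- three one-point functions. Over `ℕ` this computes degrees, over 𝔽₂ the sum over a
    -- neighbourhood.
    ∑-pick₃ : ∀ {a b c} → a ≢ b → a ≢ c → b ≢ c →
              ∑ (λ i → if does (a ≟ i) ∨ (does (b ≟ i) ∨ does (c ≟ i)) then x i else ε)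
              ≡ x a ∙ (x b ∙ x c)
    ∑-pick₃ {a} {b} {c} a≢b a≢c b≢c = begin
      ∑ (λ i → if does (a ≟ i) ∨ (does (b ≟ i) ∨ does (c ≟ i)) then x i else ε)
        ≡⟨ ∑-cong split ⟩
      ∑ (λ i → pick a i ∙ (pick b i ∙ pick c i))
        ≡⟨ ∑-∙ (pick a) (λ i → pick b i ∙ pick c i) ⟩
      ∑ (pick a) ∙ ∑ (λ i → pick b i ∙ pick c i)
        ≡⟨ cong (∑ (pick a) ∙_) (∑-∙ (pick b) (pick c)) ⟩
      ∑ (pick a) ∙ (∑ (pick b) ∙ ∑ (pick c))
        ≡⟨ cong₂ _∙_ (∑-pick a) (cong₂ _∙_ (∑-pick b) (∑-pick c)) ⟩
      x a ∙ (x b ∙ x c)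
        ∎
      where
      split : ∀ i → (if does (a ≟ i) ∨ (does (b ≟ i) ∨ does (c ≟ i)) then x i else ε)
                    ≡ pick a i ∙ (pick b i ∙ pick c i)
      split i with a ≟ i | b ≟ i | c ≟ i
      ... | yes refl | yes refl | _        = contradiction refl a≢b
      ... | yes refl | no _     | yes refl = contradiction refl a≢c
      ... | yes refl | no _     | no _     = sym (trans (cong (x i ∙_) (identityˡ ε)) (identityʳ _))
      ... | no _     | yes refl | yes refl = contradiction refl b≢c
      ... | no _     | yes refl | no _     = sym (trans (identityˡ _) (identityʳ _))
      ... | no _     | no _     | yes refl = sym (trans (identityˡ _) (identityˡ _))
      ... | no _     | no _     | no _     = sym (trans (identityˡ _) (identityˡ _))

module ∑ℕ = FiniteSum ℕ.+-0-isCommutativeMonoid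
module ∑𝔽₂ = FiniteSum (CommutativeRing.+-isCommutativeMonoid xor-∧-commutativeRing)

-- Automorphisms and a local criterion for 2-arc-transitivity.

Automorphism : ∀ {n} → Graph n → Set
Automorphism {n} G = Σ (Permutation′ n) (IsAutomorphism G)

module _ {n} (G : Graph n) where

  Adj-sym : ∀ {u v} → Adj G u v → Adj G v u
  Adj-sym {u} {v} uv = trans (adj-sym G v u) uv

  Reach-trans : ∀ {u v w} → Reach G u v → Reach G v w → Reach G u w
  Reach-trans p here       = p
  Reach-trans p (step q e) = step (Reach-trans p q) e

  Reach-sym : ∀ {u v} → Reach G u v → Reach G v u
  Reach-sym here       = here
  Reach-sym (step p e) = Reach-trans (step here (Adj-sym e)) (Reach-sym p)

  idᴬ : Automorphism G
  idᴬ = Perm.id , λ u v → refl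

  infixr 9 _∘ᴬ_
  _∘ᴬ_ : Automorphism G → Automorphism G → Automorphism G
  (α , αᴬ) ∘ᴬ (β , βᴬ) = (β ∘ₚ α) , λ u v → trans (αᴬ _ _) (βᴬ u v)

  infix 10 _⁻¹
  _⁻¹ : Automorphism G → Automorphism G
  (α , αᴬ) ⁻¹ = flip α , λ u v →
    trans (sym (αᴬ (α ⟨$⟩ˡ u) (α ⟨$⟩ˡ v))) (cong₂ (adj G) (inverseʳ α) (inverseʳ α))

  infixr 8 _◃_
  _◃_ : Automorphism G → Fin n → Fin n
  (α , _) ◃ v = α ⟨$⟩ʳ v

  ◃-Adj : ∀ α {u v} → Adj G u v → Adj G (α ◃ u) (α ◃ v)
  ◃-Adj (_ , αᴬ) uv = trans (αᴬ _ _) uv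

  ◃-⁻¹ : ∀ α v → α ◃ α ⁻¹ ◃ v ≡ v
  ◃-⁻¹ (α , _) v = inverseʳ α

  ⁻¹-◃ : ∀ α v → α ⁻¹ ◃ α ◃ v ≡ v
  ⁻¹-◃ (α , _) v = inverseˡ α

  ⁻¹-flip : ∀ α {u v} → α ◃ u ≡ v → α ⁻¹ ◃ v ≡ u
  ⁻¹-flip α {u} refl = ⁻¹-◃ α u

  ⁻¹-injective : ∀ α {u v} → α ⁻¹ ◃ u ≡ α ⁻¹ ◃ v → u ≡ v
  ⁻¹-injective α eq = trans (sym (◃-⁻¹ α _)) (trans (cong (α ◃_) eq) (◃-⁻¹ α _))

  -- `ρ` and `τ` fix `o` and act on its neighbours as two transpositions, which generate S₃; `φ`
  -- moves `o` to a neighbour. Connectedness spreads this local symmetry over the graph.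
  module _ (connected : Connected G) (o : Fin n) (nb : Fin 3 → Fin n)
    (nb-complete : ∀ {v} → Adj G o v → ∃ λ j → nb j ≡ v)
    (ρ : Automorphism G) (ρ-o : ρ ◃ o ≡ o)
    (ρ-0 : ρ ◃ nb 0F ≡ nb 1F) (ρ-1 : ρ ◃ nb 1F ≡ nb 0F) (ρ-2 : ρ ◃ nb 2F ≡ nb 2F)
    (τ : Automorphism G) (τ-o : τ ◃ o ≡ o)
    (τ-0 : τ ◃ nb 0F ≡ nb 2F) (τ-1 : τ ◃ nb 1F ≡ nb 1F) (τ-2 : τ ◃ nb 2F ≡ nb 0F)
    (φ : Automorphism G) (φ-o : φ ◃ o ≡ nb 0F)
    where

    private
      Carries : Automorphism G → Fin n → Fin n → Fin n → Set
      Carries α u v w = α ◃ nb 0F ≡ u × α ◃ o ≡ v × α ◃ nb 1F ≡ w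

      -- The six ordered pairs of distinct neighbours correspond to the six elements of S₃, each
      -- written as a word in `ρ` and `τ`.
      local : ∀ i j → nb i ≢ nb j → ∃ λ α → Carries α (nb i) o (nb j)
      local 0F 0F ≢ = contradiction refl ≢
      local 1F 1F ≢ = contradiction refl ≢
      local 2F 2F ≢ = contradiction refl ≢
      local 0F 1F _ = idᴬ , refl , refl , refl
      local 1F 0F _ = ρ , ρ-0 , ρ-o , ρ-1
      local 2F 1F _ = τ , τ-0 , τ-o , τ-1
      local 2F 0F _ = ρ ∘ᴬ τ , trans (cong (ρ ◃_) τ-0) ρ-2 , trans (cong (ρ ◃_) τ-o) ρ-o , trans (cong (ρ ◃_) τ-1) ρ-1
      local 1F 2F _ = τ ∘ᴬ ρ , trans (cong (τ ◃_) ρ-0) τ-1 , trans (cong (τ ◃_) ρ-o) τ-o , trans (cong (τ ◃_) ρ-1) τ-0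
      local 0F 2F _ = ρ ∘ᴬ τ ∘ᴬ ρ
        , trans (cong (λ v → ρ ◃ τ ◃ v) ρ-0) (trans (cong (ρ ◃_) τ-1) ρ-1)
        , trans (cong (λ v → ρ ◃ τ ◃ v) ρ-o) (trans (cong (ρ ◃_) τ-o) ρ-o)
        , trans (cong (λ v → ρ ◃ τ ◃ v) ρ-1) (trans (cong (ρ ◃_) τ-0) ρ-2)

      to-neighbour : ∀ j → ∃ λ α → α ◃ o ≡ nb j
      to-neighbour 0F = φ , φ-o
      to-neighbour 1F = ρ ∘ᴬ φ , trans (cong (ρ ◃_) φ-o) ρ-0
      to-neighbour 2F = τ ∘ᴬ φ , trans (cong (τ ◃_) φ-o) τ-0

      -- Induction along the walk: `α ⁻¹` pulls the last edge back to an edge at `o`, whose other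
      -- end is reached by `to-neighbour`, and `α` carries the result to `w`.
      vertex-transitive : ∀ {v} → Reach G o v → ∃ λ α → α ◃ o ≡ v
      vertex-transitive here = idᴬ , refl
      vertex-transitive (step {v} {w} p vw) =
        let α , αo≡v = vertex-transitive p
            j , eq   = nb-complete (subst (λ x → Adj G x (α ⁻¹ ◃ w)) (⁻¹-flip α αo≡v) (◃-Adj (α ⁻¹) vw))
            β , βo   = to-neighbour j
        in α ∘ᴬ β , trans (cong (α ◃_) (trans βo eq)) (◃-⁻¹ α w)

      -- Once the middle vertex is moved to `o`, the ends become two distinct neighbours of `o`, and
      -- `local` applies.
      from-base : ∀ {u v w} → Is2Arc G u v w → ∃ λ α → Carries α u v w
      from-base {u} {v} {w} (uv , vw , u≢w) =
        let α , αo≡v = vertex-transitive (proj₂ connected o v)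
            at-o     = λ {x} (vx : Adj G v x) →
              nb-complete (subst (λ y → Adj G y (α ⁻¹ ◃ x)) (⁻¹-flip α αo≡v) (◃-Adj (α ⁻¹) vx))
            i , nbi  = at-o (Adj-sym uv)
            j , nbj  = at-o vw
            β , β₀ , βo , β₁ = local i j λ eq → u≢w (⁻¹-injective α (trans (sym nbi) (trans eq nbj)))
        in α ∘ᴬ β
         , trans (cong (α ◃_) (trans β₀ nbi)) (◃-⁻¹ α u)
         , trans (cong (α ◃_) βo) αo≡v
         , trans (cong (α ◃_) (trans β₁ nbj)) (◃-⁻¹ α w)

    twoArcTransitive : TwoArcTransitive G
    twoArcTransitive u v w u′ v′ w′ arc arc′ =
      let α , α₀ , αo , α₁ = from-base arc
          β , β₀ , βo , β₁ = from-base arc′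
          γ , γᴬ = β ∘ᴬ α ⁻¹
      in γ , γᴬ
       , trans (cong (β ◃_) (⁻¹-flip α α₀)) β₀
       , trans (cong (β ◃_) (⁻¹-flip α αo)) βo
       , trans (cong (β ◃_) (⁻¹-flip α α₁)) β₁

-- Cubic graphs given by three neighbour maps.

opposite : Fin 3 → Fin 3
opposite 0F = 1F
opposite 1F = 0F
opposite 2F = 2F

bool-ext : ∀ {a b : Bool} → (a ≡ true → b ≡ true) → (b ≡ true → a ≡ true) → a ≡ b
bool-ext {true}          f g = sym (f refl)
bool-ext {false} {false} f g = refl
bool-ext {false} {true}  f g = g refl

module NeighbourMaps {n} (ν : Fin 3 → Fin n → Fin n)
  (ν-opposite  : ∀ j v → ν (opposite j) (ν j v) ≡ v)
  (ν-injective : ∀ v {i j} → ν i v ≡ ν j v → i ≡ j)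
  (ν-irrefl    : ∀ j v → ν j v ≢ v)
  where

  isNeighbour : Fin n → Fin n → Bool
  isNeighbour u v = does (ν 0F u ≟ v) ∨ (does (ν 1F u ≟ v) ∨ does (ν 2F u ≟ v))

  isNeighbour-ν : ∀ j v → isNeighbour v (ν j v) ≡ true
  isNeighbour-ν 0F v with ν 0F v ≟ ν 0F v
  ... | yes _ = refl
  ... | no ≢  = contradiction refl ≢
  isNeighbour-ν 1F v with ν 1F v ≟ ν 1F v
  ... | yes _ = ∨-zeroʳ _
  ... | no ≢  = contradiction refl ≢
  isNeighbour-ν 2F v with ν 2F v ≟ ν 2F v
  ... | yes _ = trans (cong (does (ν 0F v ≟ ν 2F v) ∨_) (∨-zeroʳ _)) (∨-zeroʳ _)
  ... | no ≢  = contradiction refl ≢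

  isNeighbour⇒ν : ∀ {u v} → isNeighbour u v ≡ true → ∃ λ j → ν j u ≡ v
  isNeighbour⇒ν {u} {v} eq with ν 0F u ≟ v | ν 1F u ≟ v | ν 2F u ≟ v
  ... | yes p | _     | _     = 0F , p
  ... | no _  | yes p | _     = 1F , p
  ... | no _  | no _  | yes p = 2F , p

  isNeighbour-swap : ∀ {u v} → isNeighbour u v ≡ true → isNeighbour v u ≡ true
  isNeighbour-swap {u} eq with j , refl ← isNeighbour⇒ν eq =
    subst (λ w → isNeighbour (ν j u) w ≡ true) (ν-opposite j u) (isNeighbour-ν (opposite j) (ν j u))

  graph : Graph n
  graph = record
    { adj        = isNeighbour
    ; adj-sym    = λ u v → bool-ext isNeighbour-swap isNeighbour-swap
    ; adj-irrefl = λ v → bool-ext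
        (λ eq → let j , νv≡v = isNeighbour⇒ν eq in contradiction νv≡v (ν-irrefl j v))
        (λ ())
    }

  ν-distinct : ∀ v {i j} → i ≢ j → ν i v ≢ ν j v
  ν-distinct v i≢j eq = i≢j (ν-injective v eq)

  cubic : Cubic graph
  cubic v = ∑ℕ.∑-pick₃ (λ _ → 1)
    (ν-distinct v λ ()) (ν-distinct v λ ()) (ν-distinct v λ ())

  neighbour-sum : ∀ (x : F2Vec n) v →
    sumF2 (map (λ u → isNeighbour v u ∧ x u) (allFin n)) ≡ x (ν 0F v) xor (x (ν 1F v) xor x (ν 2F v))
  neighbour-sum x v = trans
    (∑𝔽₂.∑-cong (λ u → ∧-if (isNeighbour v u)))
    (∑𝔽₂.∑-pick₃ x (ν-distinct v λ ()) (ν-distinct v λ ()) (ν-distinct v λ ()))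
    where
    ∧-if : ∀ a {b} → a ∧ b ≡ (if a then b else false)
    ∧-if true  = refl
    ∧-if false = refl

  -- Preserving adjacency is enough: since `f` is its own inverse, applying it once more shows that
  -- adjacency is also reflected.
  involution : (f : Fin n → Fin n) → (∀ v → f (f v) ≡ v) →
               (∀ j v → ∃ λ k → f (ν j v) ≡ ν k (f v)) → Automorphism graph
  involution f ff f-ν = permutation f f ff ff , λ u v →
    bool-ext (λ eq → subst₂ (λ u v → isNeighbour u v ≡ true) (ff u) (ff v) (preserves eq)) preserves
    where
    preserves : ∀ {u v} → isNeighbour u v ≡ true → isNeighbour (f u) (f v) ≡ true
    preserves {u} eq with j , refl ← isNeighbour⇒ν eq with k , fν ← f-ν j u =
      subst (λ w → isNeighbour (f u) w ≡ true) (sym fν) (isNeighbour-ν k (f u))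

-- The additive group ℤ[ζ] in the basis 1, ζ, ζ², ζ³, and integer matrices acting on it.

ℤ⁴ : Set
ℤ⁴ = ℤ × ℤ × ℤ × ℤ

tuple≡ : ∀ {a a′ b b′ c c′ d d′ : ℤ} → a ≡ a′ → b ≡ b′ → c ≡ c′ → d ≡ d′ →
         (a , b , c , d) ≡ (a′ , b′ , c′ , d′)
tuple≡ refl refl refl refl = refl

infix 4 _≟⁴_
_≟⁴_ : (x y : ℤ⁴) → Dec (x ≡ y)
_≟⁴_ = ≡-dec ℤ._≟_ (≡-dec ℤ._≟_ (≡-dec ℤ._≟_ ℤ._≟_))

0⁴ : ℤ⁴
0⁴ = 0ℤ , 0ℤ , 0ℤ , 0ℤ

infixl 6 _⊕_
_⊕_ : ℤ⁴ → ℤ⁴ → ℤ⁴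
(a , b , c , d) ⊕ (a′ , b′ , c′ , d′) = a ℤ.+ a′ , b ℤ.+ b′ , c ℤ.+ c′ , d ℤ.+ d′

⊖_ : ℤ⁴ → ℤ⁴
⊖ (a , b , c , d) = ℤ.- a , ℤ.- b , ℤ.- c , ℤ.- d

infixr 7 _·_ _⊛_
_·_ : ℤ → ℤ⁴ → ℤ⁴
k · (a , b , c , d) = k ℤ.* a , k ℤ.* b , k ℤ.* c , k ℤ.* d

⊕-assoc : ∀ x y z → (x ⊕ y) ⊕ z ≡ x ⊕ (y ⊕ z)
⊕-assoc (a , b , c , d) (a′ , b′ , c′ , d′) (a″ , b″ , c″ , d″) =
  tuple≡ (ℤ.+-assoc a a′ a″) (ℤ.+-assoc b b′ b″) (ℤ.+-assoc c c′ c″) (ℤ.+-assoc d d′ d″)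

⊕-comm : ∀ x y → x ⊕ y ≡ y ⊕ x
⊕-comm (a , b , c , d) (a′ , b′ , c′ , d′) =
  tuple≡ (ℤ.+-comm a a′) (ℤ.+-comm b b′) (ℤ.+-comm c c′) (ℤ.+-comm d d′)

⊕-identityʳ : ∀ x → x ⊕ 0⁴ ≡ x
⊕-identityʳ (a , b , c , d) =
  tuple≡ (ℤ.+-identityʳ a) (ℤ.+-identityʳ b) (ℤ.+-identityʳ c) (ℤ.+-identityʳ d)

⊕-swap : ∀ x y z → (x ⊕ y) ⊕ z ≡ (x ⊕ z) ⊕ y
⊕-swap x y z = trans (⊕-assoc x y z) (trans (cong (x ⊕_) (⊕-comm y z)) (sym (⊕-assoc x z y)))

-- A matrix is the tuple of its columns.
Matrix : Set
Matrix = ℤ⁴ × ℤ⁴ × ℤ⁴ × ℤ⁴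

_⊛_ : Matrix → ℤ⁴ → ℤ⁴
(p , q , r , s) ⊛ (a , b , c , d) = ((a · p ⊕ b · q) ⊕ c · r) ⊕ d · s

_⊚_ : Matrix → Matrix → Matrix
M ⊚ (p , q , r , s) = M ⊛ p , M ⊛ q , M ⊛ r , M ⊛ s

1ᴹ : Matrix
1ᴹ = (1ℤ , 0ℤ , 0ℤ , 0ℤ) , (0ℤ , 1ℤ , 0ℤ , 0ℤ) , (0ℤ , 0ℤ , 1ℤ , 0ℤ) , (0ℤ , 0ℤ , 0ℤ , 1ℤ)

⊛-⊕ : ∀ M x y → M ⊛ (x ⊕ y) ≡ M ⊛ x ⊕ M ⊛ y
⊛-⊕ ((p₀ , p₁ , p₂ , p₃) , (q₀ , q₁ , q₂ , q₃) , (r₀ , r₁ , r₂ , r₃) , (s₀ , s₁ , s₂ , s₃))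
    (a , b , c , d) (a′ , b′ , c′ , d′) =
  tuple≡ (row p₀ q₀ r₀ s₀) (row p₁ q₁ r₁ s₁) (row p₂ q₂ r₂ s₂) (row p₃ q₃ r₃ s₃)
  where
  additive : ∀ p q r s a b c d a′ b′ c′ d′ →
    (a ℤ.+ a′) ℤ.* p ℤ.+ (b ℤ.+ b′) ℤ.* q ℤ.+ (c ℤ.+ c′) ℤ.* r ℤ.+ (d ℤ.+ d′) ℤ.* s ≡
    (a ℤ.* p ℤ.+ b ℤ.* q ℤ.+ c ℤ.* r ℤ.+ d ℤ.* s) ℤ.+ (a′ ℤ.* p ℤ.+ b′ ℤ.* q ℤ.+ c′ ℤ.* r ℤ.+ d′ ℤ.* s)
  additive = solve-∀
  row : ∀ p q r s → _
  row p q r s = additive p q r s a b c d a′ b′ c′ d′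

⊛-· : ∀ M k x → M ⊛ (k · x) ≡ k · (M ⊛ x)
⊛-· ((p₀ , p₁ , p₂ , p₃) , (q₀ , q₁ , q₂ , q₃) , (r₀ , r₁ , r₂ , r₃) , (s₀ , s₁ , s₂ , s₃))
    k (a , b , c , d) =
  tuple≡ (row p₀ q₀ r₀ s₀) (row p₁ q₁ r₁ s₁) (row p₂ q₂ r₂ s₂) (row p₃ q₃ r₃ s₃)
  where
  homogeneous : ∀ k p q r s a b c d →
    (k ℤ.* a) ℤ.* p ℤ.+ (k ℤ.* b) ℤ.* q ℤ.+ (k ℤ.* c) ℤ.* r ℤ.+ (k ℤ.* d) ℤ.* s ≡
    k ℤ.* (a ℤ.* p ℤ.+ b ℤ.* q ℤ.+ c ℤ.* r ℤ.+ d ℤ.* s)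
  homogeneous = solve-∀
  row : ∀ p q r s → _
  row p q r s = homogeneous k p q r s a b c d

⊛-1ᴹ : ∀ x → 1ᴹ ⊛ x ≡ x
⊛-1ᴹ (a , b , c , d) = tuple≡ (e₀ a b c d) (e₁ a b c d) (e₂ a b c d) (e₃ a b c d)
  where
  e₀ : ∀ a b c d → a ℤ.* 1ℤ ℤ.+ b ℤ.* 0ℤ ℤ.+ c ℤ.* 0ℤ ℤ.+ d ℤ.* 0ℤ ≡ a
  e₀ = solve-∀
  e₁ : ∀ a b c d → a ℤ.* 0ℤ ℤ.+ b ℤ.* 1ℤ ℤ.+ c ℤ.* 0ℤ ℤ.+ d ℤ.* 0ℤ ≡ b
  e₁ = solve-∀
  e₂ : ∀ a b c d → a ℤ.* 0ℤ ℤ.+ b ℤ.* 0ℤ ℤ.+ c ℤ.* 1ℤ ℤ.+ d ℤ.* 0ℤ ≡ c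
  e₂ = solve-∀
  e₃ : ∀ a b c d → a ℤ.* 0ℤ ℤ.+ b ℤ.* 0ℤ ℤ.+ c ℤ.* 0ℤ ℤ.+ d ℤ.* 1ℤ ≡ d
  e₃ = solve-∀

⊛-⊚ : ∀ M N x → (M ⊚ N) ⊛ x ≡ M ⊛ (N ⊛ x)
⊛-⊚ M N@(p , q , r , s) x@(a , b , c , d) = sym (begin
  M ⊛ (((a · p ⊕ b · q) ⊕ c · r) ⊕ d · s)
    ≡⟨ ⊛-⊕ M ((a · p ⊕ b · q) ⊕ c · r) (d · s) ⟩
  M ⊛ ((a · p ⊕ b · q) ⊕ c · r) ⊕ M ⊛ (d · s)
    ≡⟨ cong (_⊕ M ⊛ (d · s)) (⊛-⊕ M (a · p ⊕ b · q) (c · r)) ⟩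
  (M ⊛ (a · p ⊕ b · q) ⊕ M ⊛ (c · r)) ⊕ M ⊛ (d · s)
    ≡⟨ cong (λ y → (y ⊕ M ⊛ (c · r)) ⊕ M ⊛ (d · s)) (⊛-⊕ M (a · p) (b · q)) ⟩
  ((M ⊛ (a · p) ⊕ M ⊛ (b · q)) ⊕ M ⊛ (c · r)) ⊕ M ⊛ (d · s)
    ≡⟨ cong₂ _⊕_ (cong₂ _⊕_ (cong₂ _⊕_ (⊛-· M a p) (⊛-· M b q)) (⊛-· M c r)) (⊛-· M d s) ⟩
  (M ⊚ N) ⊛ x
    ∎)
  where open ≡-Reasoning

-- The voltage graph and its infinite cover.

-- The net: the Möbius–Kantor graph G(8,3), with outer vertices u i, inner vertices w i and edges
-- u i – u (i+1), u i – w i, w i – w (i+3), carries a ℤ[ζ]-valued voltage, ζ⁴ = −1, which is ζⁱ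
-- on the arc from w i to w (i+3) and 0 on all other edges.
Base : Set
Base = Fin 2 × Fin 8

pattern u i = 0F , i
pattern w i = 1F , i

infixl 6 _+₈_
_+₈_ : Fin 8 → ℕ → Fin 8
i +₈ k = (toℕ i ℕ.+ k) mod 8

-₈_ : Fin 8 → Fin 8
-₈ i = (8 ℕ.∸ toℕ i) mod 8

timesζ : ℤ⁴ → ℤ⁴
timesζ (a , b , c , d) = ℤ.- d , a , b , c

ζ^ : Fin 8 → ℤ⁴
ζ^ i = fold (1ℤ , 0ℤ , 0ℤ , 0ℤ) timesζ (toℕ i)

neighbour : Fin 3 → Base → Base
neighbour 0F (u i) = u (i +₈ 1)
neighbour 1F (u i) = u (i +₈ 7)
neighbour 2F (u i) = w i
neighbour 0F (w i) = w (i +₈ 3)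
neighbour 1F (w i) = w (i +₈ 5)
neighbour 2F (w i) = u i

voltage : Fin 3 → Base → ℤ⁴
voltage 0F (w i) = ζ^ i
-- This arc ends at `w (i +₈ 5)` and reverses the arc labelled `0F` out of that vertex, hence the
-- sign and the exponent.
voltage 1F (w i) = ⊖ ζ^ (i +₈ 5)
voltage _  _     = 0⁴

infix 4 _≟ᴮ_
_≟ᴮ_ : (a b : Base) → Dec (a ≡ b)
_≟ᴮ_ = ≡-dec _≟_ _≟_

∀ᴮ? : ∀ {P : Base → Set} → (∀ b → Dec (P b)) → Dec (∀ b → P b)
∀ᴮ? P? = map′ (λ f (a , i) → f a i) (λ f a i → f (a , i)) (all? λ a → all? λ i → P? (a , i))

neighbour-opposite : ∀ j b → neighbour (opposite j) (neighbour j b) ≡ b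
neighbour-opposite = from-yes (all? λ j → ∀ᴮ? λ b → neighbour (opposite j) (neighbour j b) ≟ᴮ b)

voltage-opposite : ∀ j b → voltage j b ⊕ voltage (opposite j) (neighbour j b) ≡ 0⁴
voltage-opposite = from-yes (all? λ j → ∀ᴮ? λ b → voltage j b ⊕ voltage (opposite j) (neighbour j b) ≟⁴ 0⁴)

neighbour-irrefl : ∀ j b → neighbour j b ≢ b
neighbour-irrefl = from-yes (all? λ j → ∀ᴮ? λ b → ¬? (neighbour j b ≟ᴮ b))

neighbour-injective : ∀ b i j → neighbour i b ≡ neighbour j b → i ≡ j
neighbour-injective = from-yes
  (∀ᴮ? λ b → all? λ i → all? λ j → (neighbour i b ≟ᴮ neighbour j b) →-dec (i ≟ j))

Net : Set
Net = Base × ℤ⁴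

infix 4 _≟ᴺ_
_≟ᴺ_ : (x y : Net) → Dec (x ≡ y)
_≟ᴺ_ = ≡-dec _≟ᴮ_ _≟⁴_

infixl 6 _⊹_
_⊹_ : Net → ℤ⁴ → Net
(b , z) ⊹ t = b , z ⊕ t

⊹-assoc : ∀ x s t → x ⊹ s ⊹ t ≡ x ⊹ (s ⊕ t)
⊹-assoc (b , z) s t = cong (b ,_) (⊕-assoc z s t)

⊹-0⁴ : ∀ x → x ⊹ 0⁴ ≡ x
⊹-0⁴ (b , z) = cong (b ,_) (⊕-identityʳ z)

ν : Fin 3 → Net → Net
ν j (b , z) = neighbour j b , z ⊕ voltage j b

-- Translations act only on the fibre coordinate: they are the deck transformations of the cover.
ν-⊹ : ∀ j x t → ν j (x ⊹ t) ≡ ν j x ⊹ t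
ν-⊹ j (b , z) t = cong (neighbour j b ,_) (⊕-swap z t (voltage j b))

ν-opposite : ∀ j x → ν (opposite j) (ν j x) ≡ x
ν-opposite j (b , z) = cong₂ _,_ (neighbour-opposite j b)
  (trans (⊕-assoc z _ _) (trans (cong (z ⊕_) (voltage-opposite j b)) (⊕-identityʳ z)))

-- Involutions of the net, affine on the fibres.

record Involution : Set where
  field
    perm       : Base → Base
    linear     : Matrix
    shift      : Base → ℤ⁴
    perm-perm  : ∀ b → perm (perm b) ≡ b
    linear²    : linear ⊚ linear ≡ 1ᴹ
    shift-perm : ∀ b → linear ⊛ shift b ⊕ shift (perm b) ≡ 0⁴
    edges      : ∀ j b → ∃ λ k → perm (neighbour j b) ≡ neighbour k (perm b) ×
                   linear ⊛ voltage j b ⊕ shift (neighbour j b) ≡ shift b ⊕ voltage k (perm b)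

  act : Net → Net
  act (b , z) = perm b , linear ⊛ z ⊕ shift b

  -- All fibres share one linear part, so translations are carried to translations. This is what
  -- lets the action descend modulo m.
  act-⊹ : ∀ x t → act (x ⊹ t) ≡ act x ⊹ linear ⊛ t
  act-⊹ (b , z) t = cong (perm b ,_)
    (trans (cong (_⊕ shift b) (⊛-⊕ linear z t)) (⊕-swap (linear ⊛ z) (linear ⊛ t) (shift b)))

  act-act : ∀ x → act (act x) ≡ x
  act-act (b , z) = cong₂ _,_ (perm-perm b) (begin
    linear ⊛ (linear ⊛ z ⊕ shift b) ⊕ shift (perm b)
      ≡⟨ cong (_⊕ shift (perm b)) (⊛-⊕ linear (linear ⊛ z) (shift b)) ⟩
    (linear ⊛ (linear ⊛ z) ⊕ linear ⊛ shift b) ⊕ shift (perm b)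
      ≡⟨ ⊕-assoc (linear ⊛ (linear ⊛ z)) _ _ ⟩
    linear ⊛ (linear ⊛ z) ⊕ (linear ⊛ shift b ⊕ shift (perm b))
      ≡⟨ cong₂ _⊕_ (sym (⊛-⊚ linear linear z)) (shift-perm b) ⟩
    (linear ⊚ linear) ⊛ z ⊕ 0⁴
      ≡⟨ ⊕-identityʳ _ ⟩
    (linear ⊚ linear) ⊛ z
      ≡⟨ cong (_⊛ z) linear² ⟩
    1ᴹ ⊛ z
      ≡⟨ ⊛-1ᴹ z ⟩
    z ∎)
    where open ≡-Reasoning

  -- Translation reduces the claim to `edges`, a condition on the finite base graph that evaluation
  -- can decide.
  act-ν : ∀ j x → ∃ λ k → act (ν j x) ≡ ν k (act x)
  act-ν j (b , z) with k , eq , veq ← edges j b = k , cong₂ _,_ eq (begin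
    linear ⊛ (z ⊕ voltage j b) ⊕ shift (neighbour j b)
      ≡⟨ cong (_⊕ shift (neighbour j b)) (⊛-⊕ linear z (voltage j b)) ⟩
    (linear ⊛ z ⊕ linear ⊛ voltage j b) ⊕ shift (neighbour j b)
      ≡⟨ ⊕-assoc (linear ⊛ z) _ _ ⟩
    linear ⊛ z ⊕ (linear ⊛ voltage j b ⊕ shift (neighbour j b))
      ≡⟨ cong (linear ⊛ z ⊕_) veq ⟩
    linear ⊛ z ⊕ (shift b ⊕ voltage k (perm b))
      ≡⟨ ⊕-assoc (linear ⊛ z) _ _ ⟨
    (linear ⊛ z ⊕ shift b) ⊕ voltage k (perm b) ∎)
    where open ≡-Reasoning

open Involution using (act; act-act; act-⊹; act-ν)

module _ (perm : Base → Base) (linear : Matrix) (shift : Base → ℤ⁴) where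

  perm-perm? : Dec (∀ b → perm (perm b) ≡ b)
  perm-perm? = ∀ᴮ? λ b → perm (perm b) ≟ᴮ b

  shift-perm? : Dec (∀ b → linear ⊛ shift b ⊕ shift (perm b) ≡ 0⁴)
  shift-perm? = ∀ᴮ? λ b → linear ⊛ shift b ⊕ shift (perm b) ≟⁴ 0⁴

  edges? : Dec (∀ j b → ∃ λ k → perm (neighbour j b) ≡ neighbour k (perm b) ×
                   linear ⊛ voltage j b ⊕ shift (neighbour j b) ≡ shift b ⊕ voltage k (perm b))
  edges? = all? λ j → ∀ᴮ? λ b → any? λ k →
    (perm (neighbour j b) ≟ᴮ neighbour k (perm b)) ×-dec
    (linear ⊛ voltage j b ⊕ shift (neighbour j b) ≟⁴ shift b ⊕ voltage k (perm b))

-- The arc from w i to w (i+3) goes to the reverse of an arc of voltage ζ⁻ⁱ⁻³. Its voltage -ζ⁻ⁱ⁻³ =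
-- ζ¹⁻ⁱ is ζ times the conjugate of ζⁱ.
reflection : Involution
reflection = record
  { perm = perm ; linear = linear ; shift = λ _ → 0⁴
  ; perm-perm = from-yes (perm-perm? perm linear λ _ → 0⁴)
  ; linear² = refl
  ; shift-perm = from-yes (shift-perm? perm linear λ _ → 0⁴)
  ; edges = from-yes (edges? perm linear λ _ → 0⁴)
  }
  where
  perm : Base → Base
  perm (a , i) = a , -₈ i
  -- z ↦ ζ z̄
  linear : Matrix
  linear = (0ℤ , 1ℤ , 0ℤ , 0ℤ) , (1ℤ , 0ℤ , 0ℤ , 0ℤ) , (0ℤ , 0ℤ , 0ℤ , -1ℤ) , (0ℤ , 0ℤ , -1ℤ , 0ℤ)

-- Here the image of the arc from w i has voltage -ζ⁻ⁱ⁻² = ζ²⁻ⁱ, which is ζ² times the conjugate of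
-- ζⁱ. The edge from u 0 to u 1 is reversed.
edgeFlip : Involution
edgeFlip = record
  { perm = perm ; linear = linear ; shift = λ _ → 0⁴
  ; perm-perm = from-yes (perm-perm? perm linear λ _ → 0⁴)
  ; linear² = refl
  ; shift-perm = from-yes (shift-perm? perm linear λ _ → 0⁴)
  ; edges = from-yes (edges? perm linear λ _ → 0⁴)
  }
  where
  perm : Base → Base
  perm (a , i) = a , (-₈ i) +₈ 1
  -- z ↦ ζ² z̄
  linear : Matrix
  linear = (0ℤ , 0ℤ , 1ℤ , 0ℤ) , (0ℤ , 1ℤ , 0ℤ , 0ℤ) , (1ℤ , 0ℤ , 0ℤ , 0ℤ) , (0ℤ , 0ℤ , 0ℤ , -1ℤ)

-- This involution mixes outer and inner vertices, so it is not semilinear over ℤ[ζ]. Fixing (u 0, 0)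
-- forces its shift, edge by edge.
exotic : Involution
exotic = record
  { perm = perm ; linear = linear ; shift = shift
  ; perm-perm = from-yes (perm-perm? perm linear shift)
  ; linear² = refl
  ; shift-perm = from-yes (shift-perm? perm linear shift)
  ; edges = from-yes (edges? perm linear shift)
  }
  where
  perm : Base → Base
  perm (u 0F) = u 0F
  perm (u 1F) = w 0F
  perm (u 2F) = w 3F
  perm (u 3F) = u 3F
  perm (u 4F) = u 4F
  perm (u 5F) = w 4F
  perm (u 6F) = w 7F
  perm (u 7F) = u 7F
  perm (w 0F) = u 1F
  perm (w 1F) = w 5F
  perm (w 2F) = w 6F
  perm (w 3F) = u 2F
  perm (w 4F) = u 5F
  perm (w 5F) = w 1F
  perm (w 6F) = w 2F
  perm (w 7F) = u 6F
  -- Summing `edges` around a closed walk at u 0, where the shift vanishes, forces the columns: they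
  -- are the voltages of the images of closed walks with voltages 1, ζ, ζ², ζ³.
  linear : Matrix
  linear = (-1ℤ , 0ℤ , 0ℤ , 0ℤ) , (-1ℤ , 1ℤ , 0ℤ , 0ℤ) , (0ℤ , 1ℤ , -1ℤ , 1ℤ) , (1ℤ , 0ℤ , 0ℤ , 1ℤ)
  shift : Base → ℤ⁴
  shift (u 2F) = 1ℤ , 0ℤ , 0ℤ , 0ℤ
  shift (u 3F) = 1ℤ , 0ℤ , 0ℤ , 0ℤ
  shift (u 4F) = 1ℤ , 0ℤ , 0ℤ , 0ℤ
  shift (u 5F) = 1ℤ , 0ℤ , 0ℤ , 0ℤ
  shift (w 1F) = 0ℤ , 1ℤ , 0ℤ , 0ℤ
  shift (w 2F) = 1ℤ , 0ℤ , 0ℤ , 1ℤ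
  shift (w 3F) = 1ℤ , 0ℤ , 0ℤ , 0ℤ
  shift (w 4F) = 1ℤ , 0ℤ , 0ℤ , 0ℤ
  shift (w 5F) = 1ℤ , -1ℤ , 0ℤ , 0ℤ
  shift (w 6F) = 0ℤ , 0ℤ , 0ℤ , -1ℤ
  shift _      = 0⁴

-- Further lattice identities and residues modulo m.

⊕-identityˡ : ∀ x → 0⁴ ⊕ x ≡ x
⊕-identityˡ x = trans (⊕-comm 0⁴ x) (⊕-identityʳ x)

⊕-inverseʳ : ∀ x → x ⊕ ⊖ x ≡ 0⁴
⊕-inverseʳ (a , b , c , d) =
  tuple≡ (ℤ.+-inverseʳ a) (ℤ.+-inverseʳ b) (ℤ.+-inverseʳ c) (ℤ.+-inverseʳ d)

·-⊕ : ∀ k x y → k · (x ⊕ y) ≡ k · x ⊕ k · y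
·-⊕ k (a , b , c , d) (a′ , b′ , c′ , d′) = tuple≡
  (ℤ.*-distribˡ-+ k a a′) (ℤ.*-distribˡ-+ k b b′) (ℤ.*-distribˡ-+ k c c′) (ℤ.*-distribˡ-+ k d d′)

·-⊖ : ∀ k x → k · ⊖ x ≡ ⊖ (k · x)
·-⊖ k (a , b , c , d) = sym (tuple≡
  (ℤ.neg-distribʳ-* k a) (ℤ.neg-distribʳ-* k b) (ℤ.neg-distribʳ-* k c) (ℤ.neg-distribʳ-* k d))

suc-· : ∀ n x → + ℕ.suc n · x ≡ + n · x ⊕ x
suc-· n (a , b , c , d) = tuple≡ (eq a) (eq b) (eq c) (eq d)
  where
  eq : ∀ i → + ℕ.suc n ℤ.* i ≡ + n ℤ.* i ℤ.+ i
  eq i = trans (ℤ.suc-* (+ n) i) (ℤ.+-comm i (+ n ℤ.* i))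

module Residue (m : ℕ) .{{_ : ℕ.NonZero m}} where

  -- A positive `q` would force `m ≤ r`; a negative `q` is the positive case with `r` and `r′`
  -- exchanged.
  remainder-unique : ∀ {r r′} q → r < m → r′ < m → + r ≡ + r′ ℤ.+ + m ℤ.* q → r ≡ r′
  remainder-unique {r} {r′} (+ ℕ.zero) _ _ eq = ℤ.+-injective
    (trans eq (trans (cong (λ i → + r′ ℤ.+ i) (ℤ.*-zeroʳ (+ m))) (ℤ.+-identityʳ (+ r′))))
  remainder-unique {r} {r′} (+ q@(ℕ.suc _)) r<m _ eq = contradiction r<m (ℕ.≤⇒≯ m≤r)
    where
    open ℕ.≤-Reasoning
    r≡ : r ≡ r′ ℕ.+ m * q
    r≡ = ℤ.+-injective (trans eq (cong (λ i → + r′ ℤ.+ i) (sym (ℤ.pos-* m q))))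
    m≤r : m ≤ r
    m≤r = begin
      m            ≤⟨ ℕ.m≤m*n m q ⟩
      m * q        ≤⟨ ℕ.m≤n+m (m * q) r′ ⟩
      r′ ℕ.+ m * q ≡⟨ r≡ ⟨
      r            ∎
  remainder-unique {r} {r′} ℤ.-[1+ q ] r<m r′<m eq =
    sym (remainder-unique (+ ℕ.suc q) r′<m r<m (move (+ r) (+ r′) (+ m) (+ ℕ.suc q) eq))
    where
    move : ∀ a b c d → a ≡ b ℤ.+ c ℤ.* (ℤ.- d) → b ≡ a ℤ.+ c ℤ.* d
    move a b c d refl = identity b c d
      where
      identity : ∀ b c d → b ≡ (b ℤ.+ c ℤ.* (ℤ.- d)) ℤ.+ c ℤ.* d
      identity = solve-∀

  residue : ℤ → Fin m
  residue x = fromℕ< (n%ℕd<d x m)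

  toℕ-residue : ∀ x → toℕ (residue x) ≡ x %ℕ m
  toℕ-residue x = toℕ-fromℕ< (n%ℕd<d x m)

  residue-quotient : ∀ x → + toℕ (residue x) ≡ x ℤ.+ + m ℤ.* (ℤ.- (x /ℕ m))
  residue-quotient x = trans (cong +_ (toℕ-residue x)) (trans
    (identity (+ (x %ℕ m)) (x /ℕ m) (+ m))
    (cong (ℤ._+ + m ℤ.* (ℤ.- (x /ℕ m))) (sym (a≡a%ℕn+[a/ℕn]*n x m))))
    where
    identity : ∀ r q m → r ≡ (r ℤ.+ q ℤ.* m) ℤ.+ m ℤ.* (ℤ.- q)
    identity = solve-∀

  residue-periodic : ∀ x q → residue (x ℤ.+ + m ℤ.* q) ≡ residue x
  residue-periodic x q = toℕ-injective (remainder-unique (q ℤ.- y /ℕ m ℤ.+ x /ℕ m) (toℕ<n _) (toℕ<n _) (begin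
    + toℕ (residue y)
      ≡⟨ residue-quotient y ⟩
    (x ℤ.+ + m ℤ.* q) ℤ.+ + m ℤ.* (ℤ.- (y /ℕ m))
      ≡⟨ identity x (+ m) q (y /ℕ m) (x /ℕ m) ⟩
    (x ℤ.+ + m ℤ.* (ℤ.- (x /ℕ m))) ℤ.+ + m ℤ.* (q ℤ.- y /ℕ m ℤ.+ x /ℕ m)
      ≡⟨ cong (ℤ._+ + m ℤ.* (q ℤ.- y /ℕ m ℤ.+ x /ℕ m)) (residue-quotient x) ⟨
    + toℕ (residue x) ℤ.+ + m ℤ.* (q ℤ.- y /ℕ m ℤ.+ x /ℕ m)
      ∎))
    where
    open ≡-Reasoning
    y = x ℤ.+ + m ℤ.* q
    identity : ∀ x m q b a →
      (x ℤ.+ m ℤ.* q) ℤ.+ m ℤ.* (ℤ.- b) ≡ (x ℤ.+ m ℤ.* (ℤ.- a)) ℤ.+ m ℤ.* (q ℤ.- b ℤ.+ a)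
    identity = solve-∀

  residue-small : ∀ {n} → n < m → toℕ (residue (+ n)) ≡ n
  residue-small n<m = trans (toℕ-residue (+ _)) (m<n⇒m%n≡m n<m)

  residue-toℕ : ∀ i → residue (+ toℕ i) ≡ i
  residue-toℕ i = toℕ-injective (residue-small (toℕ<n i))

-- The order of the quotients, and walks in the net.

opaque
  order : ℕ → ℕ
  order m = 2 * (8 * (m * (m * (m * m))))

walk : List (Fin 3) → Net → Net
walk []       x = x
walk (j ∷ js) x = walk js (ν j x)

walk-⊹ : ∀ js x t → walk js (x ⊹ t) ≡ walk js x ⊹ t
walk-⊹ []       x t = refl
walk-⊹ (j ∷ js) x t = trans (cong (walk js) (ν-⊹ j x t)) (walk-⊹ js (ν j x) t)

origin : Net
origin = u 0F , 0⁴

-- Only outer edges and spokes are used. They carry voltage 0, so the walk stays at fibre coordinate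
-- 0.
path : Base → List (Fin 3)
path (u i) = replicate (toℕ i) 0F
path (w i) = replicate (toℕ i) 0F ++ 2F ∷ []

walk-path : ∀ b → walk (path b) origin ≡ (b , 0⁴)
walk-path = from-yes (∀ᴮ? λ b → walk (path b) origin ≟ᴺ (b , 0⁴))

-- Out along the outer cycle to u i, through the inner arc from w i to w (i+3), and back along the
-- outer cycle. That arc alone carries voltage, so each generator ζⁱ of ℤ[ζ] is realised by a closed
-- walk in the base graph.
loop : Fin 8 → List (Fin 3)
loop i = replicate (toℕ i) 0F ++ (2F ∷ 0F ∷ 2F ∷ 1F ∷ 1F ∷ 1F ∷ []) ++ replicate (toℕ i) 1F

walk-loop : ∀ i → walk (loop i) origin ≡ origin ⊹ ζ^ i
walk-loop = from-yes (all? λ i → walk (loop i) origin ≟ᴺ (origin ⊹ ζ^ i))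

-- The finite quotients of the net.

module Quotient (m : ℕ) .{{_ : ℕ.NonZero m}} where

  open Residue m

  Torsion : Set
  Torsion = Fin m × Fin m × Fin m × Fin m

  opaque
    unfolding order
    code : Fin (order m) ↔ (Fin 2 × Fin 8 × Torsion)
    code = split (split (split (split *↔×)))
      where
      split : ∀ {n k} {A : Set} → Fin k ↔ A → Fin (n * k) ↔ (Fin n × A)
      split {n} f = (↔-id (Fin n) ×-↔ f) ↔-∘ *↔×

  encode : Base × Torsion → Fin (order m)
  encode ((a , i) , t) = Inverse.from code (a , i , t)

  decode : Fin (order m) → Base × Torsion
  decode v = let a , i , t = Inverse.to code v in (a , i) , t

  encode-decode : ∀ v → encode (decode v) ≡ v
  encode-decode v = Inverse.strictlyInverseʳ code v

  decode-encode : ∀ x → decode (encode x) ≡ x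
  decode-encode ((a , i) , t) =
    cong (λ (a , i , t) → (a , i) , t) (Inverse.strictlyInverseˡ code (a , i , t))

  reduce : ℤ⁴ → Torsion
  reduce (a , b , c , d) = residue a , residue b , residue c , residue d

  lift : Torsion → ℤ⁴
  lift (p , q , r , s) = + toℕ p , + toℕ q , + toℕ r , + toℕ s

  π : Net → Fin (order m)
  π (b , z) = encode (b , reduce z)

  σ : Fin (order m) → Net
  σ v = let b , t = decode v in b , lift t

  π-σ : ∀ v → π (σ v) ≡ v
  π-σ v = trans
    (cong (λ t → encode (proj₁ (decode v) , t))
      (cong₂ _,_ (residue-toℕ _) (cong₂ _,_ (residue-toℕ _) (cong₂ _,_ (residue-toℕ _) (residue-toℕ _)))))
    (encode-decode v)

  σ-π : ∀ x → ∃ λ k → σ (π x) ≡ x ⊹ + m · k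
  -- The omitted witness consists of the negated quotients in `residue-quotient`.
  σ-π (b , z@(a₀ , a₁ , a₂ , a₃)) = _ , trans
    (cong (λ (b , t) → b , lift t) (decode-encode (b , reduce z)))
    (cong (b ,_) (tuple≡ (residue-quotient a₀) (residue-quotient a₁) (residue-quotient a₂) (residue-quotient a₃)))

  π-periodic : ∀ x k → π (x ⊹ + m · k) ≡ π x
  π-periodic (b , (a₀ , a₁ , a₂ , a₃)) (k₀ , k₁ , k₂ , k₃) = cong (λ t → encode (b , t))
    (cong₂ _,_ (residue-periodic a₀ k₀) (cong₂ _,_ (residue-periodic a₁ k₁)
      (cong₂ _,_ (residue-periodic a₂ k₂) (residue-periodic a₃ k₃))))

  base-π : ∀ {x y} → π x ≡ π y → proj₁ x ≡ proj₁ y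
  base-π {x} {y} eq = trans (sym (cong proj₁ (decode-encode (proj₁ x , reduce (proj₂ x)))))
    (trans (cong (proj₁ ∘ decode) eq) (cong proj₁ (decode-encode (proj₁ y , reduce (proj₂ y)))))

  reduce-π : ∀ {x y} → π x ≡ π y → reduce (proj₂ x) ≡ reduce (proj₂ y)
  reduce-π {x} {y} eq = trans (sym (cong proj₂ (decode-encode (proj₁ x , reduce (proj₂ x)))))
    (trans (cong (proj₂ ∘ decode) eq) (cong proj₂ (decode-encode (proj₁ y , reduce (proj₂ y)))))

  -- Both points are congruent to their common representative under `σ`; the two multiples of m are
  -- subtracted.
  congruent : ∀ {x y} → π x ≡ π y → ∃ λ k → x ≡ y ⊹ + m · k
  congruent {x} {y} eq =
    let k , eqx = σ-π x
        l , eqy = σ-π y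
    in l ⊕ ⊖ k , (begin
      x                                   ≡⟨ ⊹-0⁴ x ⟨
      x ⊹ 0⁴                              ≡⟨ cong (x ⊹_) (⊕-inverseʳ (+ m · k)) ⟨
      x ⊹ (+ m · k ⊕ ⊖ (+ m · k))         ≡⟨ ⊹-assoc x _ _ ⟨
      x ⊹ + m · k ⊹ ⊖ (+ m · k)           ≡⟨ cong (_⊹ ⊖ (+ m · k)) (trans (sym eqx) (trans (cong σ eq) eqy)) ⟩
      y ⊹ + m · l ⊹ ⊖ (+ m · k)           ≡⟨ ⊹-assoc y _ _ ⟩
      y ⊹ (+ m · l ⊕ ⊖ (+ m · k))         ≡⟨ cong (λ t → y ⊹ (+ m · l ⊕ t)) (·-⊖ (+ m) k) ⟨
      y ⊹ (+ m · l ⊕ + m · ⊖ k)           ≡⟨ cong (y ⊹_) (·-⊕ (+ m) l (⊖ k)) ⟨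
      y ⊹ + m · (l ⊕ ⊖ k)                 ∎)
    where open ≡-Reasoning

  -- `σ (π x)` differs from `x` by a multiple of m, and `f` turns that into a multiple of m again
  -- because `L` is homogeneous.
  descends : (f : Net → Net) (L : ℤ⁴ → ℤ⁴) → (∀ x t → f (x ⊹ t) ≡ f x ⊹ L t) →
             (∀ k t → L (k · t) ≡ k · L t) → ∀ x → π (f (σ (π x))) ≡ π (f x)
  descends f L f-⊹ L-· x = let k , eq = σ-π x in begin
    π (f (σ (π x)))       ≡⟨ cong (π ∘ f) eq ⟩
    π (f (x ⊹ + m · k))   ≡⟨ cong π (f-⊹ x (+ m · k)) ⟩
    π (f x ⊹ L (+ m · k)) ≡⟨ cong (λ t → π (f x ⊹ t)) (L-· (+ m) k) ⟩
    π (f x ⊹ + m · L k)   ≡⟨ π-periodic (f x) (L k) ⟩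
    π (f x)               ∎
    where open ≡-Reasoning

  ν̄ : Fin 3 → Fin (order m) → Fin (order m)
  ν̄ j v = π (ν j (σ v))

  ν̄-π : ∀ j x → ν̄ j (π x) ≡ π (ν j x)
  ν̄-π j = descends (ν j) id (ν-⊹ j) (λ _ _ → refl)

  ν̄-opposite : ∀ j v → ν̄ (opposite j) (ν̄ j v) ≡ v
  ν̄-opposite j v = trans (ν̄-π (opposite j) (ν j (σ v)))
    (trans (cong π (ν-opposite j (σ v))) (π-σ v))

  -- Projection to the base graph settles this, as its three neighbour maps already take distinct
  -- values at every vertex.
  ν̄-injective : ∀ v {i j} → ν̄ i v ≡ ν̄ j v → i ≡ j
  ν̄-injective v {i} {j} eq =
    neighbour-injective (proj₁ (σ v)) i j (base-π {ν i (σ v)} {ν j (σ v)} eq)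

  ν̄-irrefl : ∀ j v → ν̄ j v ≢ v
  ν̄-irrefl j v eq =
    neighbour-irrefl j (proj₁ (σ v)) (base-π {ν j (σ v)} {σ v} (trans eq (sym (π-σ v))))

  open NeighbourMaps ν̄ ν̄-opposite ν̄-injective ν̄-irrefl public

  ν-Adj : ∀ j x → Adj graph (π x) (π (ν j x))
  ν-Adj j x = subst (Adj graph (π x)) (ν̄-π j x) (isNeighbour-ν j (π x))

  walk-Reach : ∀ js x → Reach graph (π x) (π (walk js x))
  walk-Reach []       x = here
  walk-Reach (j ∷ js) x = Reach-trans graph (step here (ν-Adj j x)) (walk-Reach js (ν j x))

  loop-Reach : ∀ i n t → Reach graph (π (origin ⊹ t)) (π (origin ⊹ (t ⊕ + n · ζ^ i)))
  loop-Reach i ℕ.zero t = subst (Reach graph _) (cong (λ s → π (origin ⊹ s)) (sym (⊕-identityʳ t))) here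
  loop-Reach i (ℕ.suc n) t = Reach-trans graph (loop-Reach i n t)
    (subst (Reach graph _) (cong π (begin
      walk (loop i) (origin ⊹ s)             ≡⟨ walk-⊹ (loop i) origin s ⟩
      walk (loop i) origin ⊹ s               ≡⟨ cong (_⊹ s) (walk-loop i) ⟩
      origin ⊹ ζ^ i ⊹ s                      ≡⟨ ⊹-assoc origin (ζ^ i) s ⟩
      origin ⊹ (ζ^ i ⊕ (t ⊕ + n · ζ^ i))     ≡⟨ cong (origin ⊹_) (⊕-comm (ζ^ i) s) ⟩
      origin ⊹ (t ⊕ + n · ζ^ i ⊕ ζ^ i)       ≡⟨ cong (origin ⊹_) (⊕-assoc t (+ n · ζ^ i) (ζ^ i)) ⟩
      origin ⊹ (t ⊕ (+ n · ζ^ i ⊕ ζ^ i))     ≡⟨ cong (λ x → origin ⊹ (t ⊕ x)) (suc-· n (ζ^ i)) ⟨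
      origin ⊹ (t ⊕ + ℕ.suc n · ζ^ i)        ∎))
      (walk-Reach (loop i) (origin ⊹ s)))
    where
    open ≡-Reasoning
    s = t ⊕ + n · ζ^ i

  -- Repeating loops 0 to 3 adds up to the expression that `1ᴹ ⊛ (a , b , c , d)` unfolds to.
  -- Natural coefficients suffice, since `σ` picks representatives with nonnegative coordinates.
  loops-Reach : ∀ a b c d →
    Reach graph (π origin) (π (origin ⊹ (1ᴹ ⊛ (+ a , + b , + c , + d))))
  loops-Reach a b c d = Reach-trans graph
    (subst (λ t → Reach graph (π origin) (π (origin ⊹ t))) (⊕-identityˡ t₁) (loop-Reach 0F a 0⁴))
    (Reach-trans graph (loop-Reach 1F b t₁)
    (Reach-trans graph (loop-Reach 2F c t₂)
                       (loop-Reach 3F d t₃)))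
    where
    t₁ = + a · ζ^ 0F
    t₂ = t₁ ⊕ + b · ζ^ 1F
    t₃ = t₂ ⊕ + c · ζ^ 2F

  origin-Reach : ∀ v → Reach graph (π origin) v
  origin-Reach v =
    let b , p , q , r , s = decode v
        z = lift (p , q , r , s)
    in subst (Reach graph (π origin)) (trans (cong π (to-σ b z)) (π-σ v))
         (Reach-trans graph (loops-Reach (toℕ p) (toℕ q) (toℕ r) (toℕ s))
           (walk-Reach (path b) (origin ⊹ (1ᴹ ⊛ z))))
    where
    to-σ : ∀ b z → walk (path b) (origin ⊹ (1ᴹ ⊛ z)) ≡ (b , z)
    to-σ b z = begin
      walk (path b) (origin ⊹ (1ᴹ ⊛ z)) ≡⟨ walk-⊹ (path b) origin (1ᴹ ⊛ z) ⟩
      walk (path b) origin ⊹ (1ᴹ ⊛ z)   ≡⟨ cong₂ _⊹_ (walk-path b) (⊛-1ᴹ z) ⟩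
      b , 0⁴ ⊕ z                        ≡⟨ cong (b ,_) (⊕-identityˡ z) ⟩
      b , z                             ∎
      where open ≡-Reasoning

  connected : Connected graph
  connected = ℕ.≤-<-trans ℕ.z≤n (toℕ<n (π origin)) , λ v v′ →
    Reach-trans graph (Reach-sym graph (origin-Reach v)) (origin-Reach v′)

  module _ (ι : Involution) where

    act-π : ∀ x → π (act ι (σ (π x))) ≡ π (act ι x)
    act-π = descends (act ι) (Involution.linear ι ⊛_) (act-⊹ ι) (⊛-· (Involution.linear ι))

    automorphism : Automorphism graph
    automorphism = involution (λ v → π (act ι (σ v)))
      (λ v → trans (act-π (act ι (σ v))) (trans (cong π (act-act ι (σ v))) (π-σ v)))
      (λ j v → let k , eq = act-ν ι j (σ v) in
        k , trans (act-π (ν j (σ v))) (trans (cong π eq) (sym (ν̄-π k (act ι (σ v))))))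

    act-ν̄ : ∀ j x k y → act ι (ν j x) ≡ ν k y → _◃_ graph automorphism (ν̄ j (π x)) ≡ ν̄ k (π y)
    act-ν̄ j x k y eq = trans (cong (λ v → π (act ι (σ v))) (ν̄-π j x))
      (trans (act-π (ν j x)) (trans (cong π eq) (sym (ν̄-π k y))))

  private
    o : Fin (order m)
    o = π origin

    image : ∀ ι j k → act ι (ν j origin) ≡ ν k (act ι origin) → act ι origin ≡ origin →
            _◃_ graph (automorphism ι) (ν̄ j o) ≡ ν̄ k o
    image ι j k eq fix = act-ν̄ ι j origin k origin (trans eq (cong (ν k) fix))

  -- The local conditions hold by computation at `origin` in the net and are transported by `π`,
  -- uniformly in m. The reflection swaps neighbours 0 and 1, the exotic involution swaps 0 and 2.
  2-arc-transitive : TwoArcTransitive graph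
  2-arc-transitive = twoArcTransitive graph connected o (λ j → ν̄ j o) isNeighbour⇒ν
    (automorphism reflection) (act-π reflection origin)
    (image reflection 0F 1F refl refl) (image reflection 1F 0F refl refl) (image reflection 2F 2F refl refl)
    (automorphism exotic) (act-π exotic origin)
    (image exotic 0F 2F refl refl) (image exotic 1F 1F refl refl) (image exotic 2F 0F refl refl)
    (automorphism edgeFlip) (trans (act-π edgeFlip origin) (sym (ν̄-π 0F origin)))

-- A finite set in the net that meets closed neighbourhoods evenly.

-- The support, found by a computer search, is invariant under this automorphism of order 8.
rotate : Net → Net
rotate ((a , i) , z) = (a , i +₈ 1) , timesζ z

-- Orbit representatives: four over u 0 and six over w 0, giving 80 vertices under the eight
-- rotations. The origin comes first because the independence argument splits off the head of the
-- support.
seeds : List Net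
seeds =
  (u 0F , 0⁴) ∷
  (u 0F , (-1ℤ , 1ℤ , -1ℤ , 0ℤ)) ∷
  (u 0F , (0ℤ , 0ℤ , -1ℤ , 1ℤ)) ∷
  (u 0F , (1ℤ , -1ℤ , 0ℤ , 1ℤ)) ∷
  (w 0F , 0⁴) ∷
  (w 0F , (-1ℤ , 0ℤ , 0ℤ , -1ℤ)) ∷
  (w 0F , (-1ℤ , 0ℤ , 1ℤ , -1ℤ)) ∷
  (w 0F , (0ℤ , -1ℤ , 1ℤ , -1ℤ)) ∷
  (w 0F , (0ℤ , -1ℤ , 1ℤ , 0ℤ)) ∷
  (w 0F , (0ℤ , 0ℤ , -1ℤ , 1ℤ)) ∷ []

support : List Net
support = concat (iterate (map rotate) seeds 8)

closedNeighbourhood : Net → List Net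
closedNeighbourhood x = x ∷ ν 0F x ∷ ν 1F x ∷ ν 2F x ∷ []

-- Addition of a point modulo 2, with lists as formal sums over 𝔽₂: a second occurrence cancels the
-- first.
toggle : Net → List Net → List Net
toggle x []       = x ∷ []
toggle x (y ∷ ys) = if does (x ≟ᴺ y) then ys else y ∷ toggle x ys

-- Every vertex cancels, so it lies in the closed neighbourhoods of evenly many support vertices; by
-- symmetry of adjacency its own closed neighbourhood meets the support evenly.
closedNeighbourhoods-even : foldr toggle [] (concatMap closedNeighbourhood support) ≡ []
closedNeighbourhoods-even = refl

∑ᴸ : (Net → Bool) → List Net → Bool
∑ᴸ h xs = sumF2 (map h xs)

module _ (h : Net → Bool) where

  ∑ᴸ-toggle : ∀ x ys → ∑ᴸ h (toggle x ys) ≡ h x xor ∑ᴸ h ys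
  ∑ᴸ-toggle x [] = refl
  ∑ᴸ-toggle x (y ∷ ys) with x ≟ᴺ y
  ... | yes refl = sym (trans (sym (xor-assoc (h x) (h x) _)) (cong (_xor ∑ᴸ h ys) (xor-same (h x))))
  ... | no _     = trans (cong (h y xor_) (∑ᴸ-toggle x ys))
    (trans (sym (xor-assoc (h y) (h x) _))
      (trans (cong (_xor ∑ᴸ h ys) (xor-comm (h y) (h x))) (xor-assoc (h x) (h y) _)))

  ∑ᴸ-foldr-toggle : ∀ xs → ∑ᴸ h (foldr toggle [] xs) ≡ ∑ᴸ h xs
  ∑ᴸ-foldr-toggle []       = refl
  ∑ᴸ-foldr-toggle (x ∷ xs) = trans (∑ᴸ-toggle x (foldr toggle [] xs)) (cong (h x xor_) (∑ᴸ-foldr-toggle xs))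

  ∑ᴸ-closedNeighbourhood : ∀ xs → ∑ᴸ h (concatMap closedNeighbourhood xs) ≡
    (∑ᴸ h xs xor ∑ᴸ (h ∘ ν 0F) xs) xor (∑ᴸ (h ∘ ν 1F) xs xor ∑ᴸ (h ∘ ν 2F) xs)
  ∑ᴸ-closedNeighbourhood []       = refl
  ∑ᴸ-closedNeighbourhood (x ∷ xs) = begin
    h₁ xor (h₂ xor (h₃ xor (h₄ xor ∑ᴸ h (concatMap closedNeighbourhood xs))))
      ≡⟨ cong (λ s → h₁ xor (h₂ xor (h₃ xor (h₄ xor s)))) (∑ᴸ-closedNeighbourhood xs) ⟩
    h₁ xor (h₂ xor (h₃ xor (h₄ xor ((s₁ xor s₂) xor (s₃ xor s₄)))))
      ≡⟨ cong (λ s → h₁ xor (h₂ xor s)) (xor-assoc h₃ h₄ _) ⟨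
    h₁ xor (h₂ xor ((h₃ xor h₄) xor ((s₁ xor s₂) xor (s₃ xor s₄))))
      ≡⟨ xor-assoc h₁ h₂ _ ⟨
    (h₁ xor h₂) xor ((h₃ xor h₄) xor ((s₁ xor s₂) xor (s₃ xor s₄)))
      ≡⟨ xor-assoc (h₁ xor h₂) (h₃ xor h₄) _ ⟨
    ((h₁ xor h₂) xor (h₃ xor h₄)) xor ((s₁ xor s₂) xor (s₃ xor s₄))
      ≡⟨ interchange (h₁ xor h₂) (h₃ xor h₄) (s₁ xor s₂) (s₃ xor s₄) ⟩
    ((h₁ xor h₂) xor (s₁ xor s₂)) xor ((h₃ xor h₄) xor (s₃ xor s₄))
      ≡⟨ cong₂ _xor_ (interchange h₁ h₂ s₁ s₂) (interchange h₃ h₄ s₃ s₄) ⟩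
    ((h₁ xor s₁) xor (h₂ xor s₂)) xor ((h₃ xor s₃) xor (h₄ xor s₄))
      ∎
    where
    open ≡-Reasoning
    open ∑𝔽₂ using (interchange)
    h₁ = h x
    h₂ = h (ν 0F x)
    h₃ = h (ν 1F x)
    h₄ = h (ν 2F x)
    s₁ = ∑ᴸ h xs
    s₂ = ∑ᴸ (h ∘ ν 0F) xs
    s₃ = ∑ᴸ (h ∘ ν 1F) xs
    s₄ = ∑ᴸ (h ∘ ν 2F) xs

  -- The sum of any `h` over all the closed neighbourhoods vanishes by cancellation. The labels come
  -- in the order 1, 0, 2 because `opposite` sends 0, 1, 2 to these.
  ∑ᴸ-support : ∑ᴸ (h ∘ ν 1F) support xor (∑ᴸ (h ∘ ν 0F) support xor ∑ᴸ (h ∘ ν 2F) support) ≡ ∑ᴸ h support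
  ∑ᴸ-support = cancel _ (∑ᴸ (h ∘ ν 0F) support) (∑ᴸ (h ∘ ν 1F) support) _ (begin
    (∑ᴸ h support xor ∑ᴸ (h ∘ ν 0F) support) xor (∑ᴸ (h ∘ ν 1F) support xor ∑ᴸ (h ∘ ν 2F) support)
      ≡⟨ ∑ᴸ-closedNeighbourhood support ⟨
    ∑ᴸ h (concatMap closedNeighbourhood support)
      ≡⟨ ∑ᴸ-foldr-toggle (concatMap closedNeighbourhood support) ⟨
    ∑ᴸ h (foldr toggle [] (concatMap closedNeighbourhood support))
      ≡⟨ cong (∑ᴸ h) closedNeighbourhoods-even ⟩
    false
      ∎)
    where
    open ≡-Reasoning
    cancel : ∀ a b c d → (a xor b) xor (c xor d) ≡ false → c xor (b xor d) ≡ a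
    cancel false false false false _ = refl
    cancel false false true  true  _ = refl
    cancel false true  false true  _ = refl
    cancel false true  true  false _ = refl
    cancel true  false false true  _ = refl
    cancel true  false true  false _ = refl
    cancel true  true  false false _ = refl
    cancel true  true  true  true  _ = refl

∑ᴸ-cong : ∀ {f g : Net → Bool} → (∀ x → f x ≡ g x) → ∀ xs → ∑ᴸ f xs ≡ ∑ᴸ g xs
∑ᴸ-cong eq xs = cong sumF2 (map-cong eq xs)

∑ᴸ-false : ∀ {f : Net → Bool} {xs} → All (λ x → f x ≡ false) xs → ∑ᴸ f xs ≡ false
∑ᴸ-false []         = refl
∑ᴸ-false (px ∷ pxs) = cong₂ _xor_ px (∑ᴸ-false pxs)

opposite-involutive : ∀ j → opposite (opposite j) ≡ j
opposite-involutive 0F = refl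
opposite-involutive 1F = refl
opposite-involutive 2F = refl

-- Eigenvectors from translates of the support.

module Eigenvectors (m : ℕ) .{{_ : ℕ.NonZero m}} where

  open Quotient m

  -- A parity rather than a membership test: support vertices that coincide modulo m cancel, which
  -- keeps the eigenvector equation valid for every nonzero m.
  indicator : ℤ⁴ → F2Vec (order m)
  indicator t v = ∑ᴸ (λ x → does (π (x ⊹ t) ≟ v)) support

  -- A step from `v` along label `j` is undone by a step along `opposite j`, so the step can be
  -- moved from `v` to the support.
  indicator-ν : ∀ t v j → indicator t (ν̄ j v) ≡ ∑ᴸ (λ x → does (π (ν (opposite j) x ⊹ t) ≟ v)) support
  indicator-ν t v j = ∑ᴸ-cong (λ x → does-⇔ (mk⇔ (to x) (from x)) (π (x ⊹ t) ≟ ν̄ j v) (π (ν (opposite j) x ⊹ t) ≟ v)) support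
    where
    back : ∀ x → ν̄ (opposite j) (π (x ⊹ t)) ≡ π (ν (opposite j) x ⊹ t)
    back x = trans (ν̄-π (opposite j) (x ⊹ t)) (cong π (ν-⊹ (opposite j) x t))
    to : ∀ x → π (x ⊹ t) ≡ ν̄ j v → π (ν (opposite j) x ⊹ t) ≡ v
    to x eq = trans (sym (back x)) (trans (cong (ν̄ (opposite j)) eq) (ν̄-opposite j v))
    from : ∀ x → π (ν (opposite j) x ⊹ t) ≡ v → π (x ⊹ t) ≡ ν̄ j v
    from x eq = trans (sym (ν̄-opposite (opposite j) (π (x ⊹ t))))
      (cong₂ ν̄ (opposite-involutive j) (trans (back x) eq))

  indicator-eigen : ∀ t → In1Eigenspace graph (indicator t)
  indicator-eigen t v = trans (neighbour-sum (indicator t) v)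
    (trans (cong₂ _xor_ (indicator-ν t v 0F) (cong₂ _xor_ (indicator-ν t v 1F) (indicator-ν t v 2F)))
           (∑ᴸ-support (λ x → does (π (x ⊹ t) ≟ v))))

-- Linear independence of a quarter of the translates.

-- For even m the translates of the support by vectors t with t₀ and t₃ even are linearly independent:
-- the only vertex of the support over u 0 whose coordinates 0 and 3 are both even is the origin.
Even₀₃ : Net → Set
Even₀₃ (b , (z₀ , _ , _ , z₃)) = b ≡ u 0F × + 2 ∣ z₀ × + 2 ∣ z₃

support-Even₀₃ : All (¬_ ∘ Even₀₃) (drop 1 support)
support-Even₀₃ = from-yes (All.all? (¬? ∘ λ (b , (z₀ , _ , _ , z₃)) →
  (b ≟ᴮ u 0F) ×-dec (+ 2 ∣? z₀) ×-dec (+ 2 ∣? z₃)) (drop 1 support))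

-- For m = 2k this is m⁴/4, the number of vectors modulo m with even outer coordinates, bracketed
-- like the nested pairs of `Index`.
dimension : ℕ → ℕ
dimension k = k * (2 * k * (2 * k * k))

module Independence (k : ℕ) .{{_ : ℕ.NonZero k}} where

  private
    m : ℕ
    m = 2 * k
    instance
      m≢0 : ℕ.NonZero m
      m≢0 = ℕ.m*n≢0 2 k

  open Residue m
  open Quotient m
  open Eigenvectors m

  double : Fin k → ℤ
  double i = + (2 * toℕ i)

  double-injective : ∀ i j → residue (double i) ≡ residue (double j) → i ≡ j
  double-injective i j eq = toℕ-injective (ℕ.*-cancelˡ-≡ _ _ 2 (begin
    2 * toℕ i                  ≡⟨ residue-small (ℕ.*-monoʳ-< 2 (toℕ<n i)) ⟨
    toℕ (residue (double i))   ≡⟨ cong toℕ eq ⟩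
    toℕ (residue (double j))   ≡⟨ residue-small (ℕ.*-monoʳ-< 2 (toℕ<n j)) ⟩
    2 * toℕ j                  ∎))
    where open ≡-Reasoning

  -- The evenness of m enters here: every term of the equation other than `z` is a multiple of 2.
  even-difference : ∀ i j z q → z ℤ.+ double i ≡ double j ℤ.+ + m ℤ.* q → + 2 ∣ z
  even-difference i j z q eq = divides (+ toℕ j ℤ.+ + k ℤ.* q ℤ.- + toℕ i)
    (solve z (+ toℕ i) (+ toℕ j) (+ k) q
      (subst₂ (λ a b → z ℤ.+ a ≡ b) (ℤ.pos-* 2 (toℕ i))
        (cong₂ (λ a b → a ℤ.+ b ℤ.* q) (ℤ.pos-* 2 (toℕ j)) (ℤ.pos-* 2 k)) eq))
    where
    solve : ∀ z i j k q → z ℤ.+ + 2 ℤ.* i ≡ + 2 ℤ.* j ℤ.+ + 2 ℤ.* k ℤ.* q →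
            z ≡ (j ℤ.+ k ℤ.* q ℤ.- i) ℤ.* + 2
    solve z i j k q eq = trans (before z i) (trans (cong (ℤ._- + 2 ℤ.* i) eq) (after i j k q))
      where
      before : ∀ z i → z ≡ (z ℤ.+ + 2 ℤ.* i) ℤ.- + 2 ℤ.* i
      before = solve-∀
      after : ∀ i j k q → (+ 2 ℤ.* j ℤ.+ + 2 ℤ.* k ℤ.* q) ℤ.- + 2 ℤ.* i ≡ (j ℤ.+ k ℤ.* q ℤ.- i) ℤ.* + 2
      after = solve-∀

  Index : Set
  Index = Fin k × Fin m × Fin m × Fin k

  index : Fin (dimension k) ↔ Index
  index = (↔-id _ ×-↔ ((↔-id _ ×-↔ *↔×) ↔-∘ *↔×)) ↔-∘ *↔×

  index-injective : ∀ {i j} → Inverse.to index i ≡ Inverse.to index j → i ≡ j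
  index-injective {i} {j} eq = trans (sym (Inverse.strictlyInverseʳ index i))
    (trans (cong (Inverse.from index) eq) (Inverse.strictlyInverseʳ index j))

  translation : Index → ℤ⁴
  translation (a , b , c , d) = double a , + toℕ b , + toℕ c , double d

  translation-injective : ∀ s t → reduce (translation s) ≡ reduce (translation t) → s ≡ t
  translation-injective (a , b , c , d) (a′ , b′ , c′ , d′) eq
    = cong₂ _,_ (double-injective a a′ (cong proj₁ eq))
      (cong₂ _,_ (toℕ-residue-injective b b′ (cong (proj₁ ∘ proj₂) eq))
        (cong₂ _,_ (toℕ-residue-injective c c′ (cong (proj₁ ∘ proj₂ ∘ proj₂) eq))
          (double-injective d d′ (cong (proj₂ ∘ proj₂ ∘ proj₂) eq))))
    where
    toℕ-residue-injective : ∀ i j → residue (+ toℕ i) ≡ residue (+ toℕ j) → i ≡ j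
    toℕ-residue-injective i j eq = trans (sym (residue-toℕ i)) (trans eq (residue-toℕ j))

  marker : Index → Fin (order m)
  marker t = π (u 0F , translation t)

  -- A hit would put `x` over u 0, and since both translations have even outer coordinates, those of
  -- `x` would be even as well.
  marker-misses : ∀ {x} s t → ¬ Even₀₃ x → π (x ⊹ translation s) ≢ marker t
  marker-misses {x@(_ , (z₀ , _ , _ , z₃))} s@(a , _ , _ , d) t@(a′ , _ , _ , d′) odd eq =
    let (q₀ , _ , _ , q₃) , eq′ = congruent {x ⊹ translation s} {u 0F , translation t} eq
    in odd ( cong proj₁ eq′
           , even-difference a a′ z₀ q₀ (cong (proj₁ ∘ proj₂) eq′)
           , even-difference d d′ z₃ q₃ (cong (proj₂ ∘ proj₂ ∘ proj₂ ∘ proj₂) eq′))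

  marker-origin : ∀ s t → π (origin ⊹ translation s) ≡ marker t → s ≡ t
  marker-origin s t eq = translation-injective s t
    (trans (cong reduce (sym (⊕-identityˡ (translation s))))
           (reduce-π {origin ⊹ translation s} {u 0F , translation t} eq))

  indicator-marker : ∀ s t → indicator (translation s) (marker t) ≡ does (π (origin ⊹ translation s) ≟ marker t)
  indicator-marker s t = trans
    -- The head of the support is the origin; all its other vertices contribute `false`.
    (cong (does (π (origin ⊹ translation s) ≟ marker t) xor_)
      (∑ᴸ-false (All.map (λ {x} odd → dec-false (π (x ⊹ translation s) ≟ marker t) (marker-misses {x} s t odd)) support-Even₀₃)))
    (xor-identityʳ _)

  eigenvector : Fin (dimension k) → F2Vec (order m)
  eigenvector i = indicator (translation (Inverse.to index i))

  -- Evaluated at the markers, the eigenvectors form the identity matrix, so each coefficient of a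
  -- combination can be read off.
  eigenvector-marker : ∀ c i → linComb eigenvector c (marker (Inverse.to index i)) ≡ c i
  eigenvector-marker c i = trans (∑𝔽₂.∑-single i off) at
    where
    t = Inverse.to index i
    off : ∀ j → j ≢ i → c j ∧ eigenvector j (marker t) ≡ false
    off j j≢i = trans (cong (c j ∧_) (trans (indicator-marker (Inverse.to index j) t)
      (dec-false (π (origin ⊹ translation (Inverse.to index j)) ≟ marker t)
        λ eq → j≢i (index-injective (marker-origin (Inverse.to index j) t eq))))) (∧-zeroʳ (c j))
    at : c i ∧ eigenvector i (marker t) ≡ c i
    at = trans (cong (c i ∧_) (trans (indicator-marker t t)
      (dec-true (π (origin ⊹ translation t) ≟ marker t)
        (cong (λ z → π (u 0F , z)) (⊕-identityˡ (translation t)))))) (∧-identityʳ (c i))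

  eigenvectors-independent : LinIndep eigenvector
  eigenvectors-independent c zero-comb i =
    trans (sym (eigenvector-marker c i)) (zero-comb (marker (Inverse.to index i)))

  eigenspace : EigDimAtLeast graph (dimension k)
  eigenspace = eigenvector , (λ i → indicator-eigen (translation (Inverse.to index i))) , eigenvectors-independent

-- Orders, dimensions and the infinite family.

opaque
  unfolding order

  order-mono : ∀ {m n} → m < n → order m < order n
  order-mono m<n = ℕ.*-monoʳ-< 2 (ℕ.*-monoʳ-< 8
    (ℕ.*-mono-< m<n (ℕ.*-mono-< m<n (ℕ.*-mono-< m<n m<n))))

  order-dimension : ∀ k → order (2 * k) ≡ 64 * dimension k
  order-dimension = expand
    where
    expand : ∀ k → 2 * (8 * (2 * k * (2 * k * (2 * k * (2 * k))))) ≡ 64 * (k * (2 * k * (2 * k * k)))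
    expand = ℕ-solve-∀

theorem1p2 : Σ (ℕ → ℕ) λ ord →
    (∀ i → ord i < ord (ℕ.suc i)) ×
    Σ ((i : ℕ) → Graph (ord i)) λ Λ → ∀ i →
    Connected (Λ i) × Cubic (Λ i) × TwoArcTransitive (Λ i) ×
    Σ ℕ λ d → EigDimAtLeast (Λ i) d × ord i ≤ 72 * d
theorem1p2 =
    (λ i → order (modulus i))
  , (λ i → order-mono (ℕ.*-monoʳ-< 2 (ℕ.n<1+n (ℕ.suc i))))
  , (λ i → Quotient.graph (modulus i))
  , λ i → Quotient.connected (modulus i) , Quotient.cubic (modulus i) , Quotient.2-arc-transitive (modulus i)
        , dimension (ℕ.suc i) , Independence.eigenspace (ℕ.suc i)
        -- The order is exactly 64 times the dimension bound, and 64 + 8 = 72.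
        , ℕ.≤-trans (ℕ.≤-reflexive (order-dimension (ℕ.suc i))) (ℕ.*-monoˡ-≤ (dimension (ℕ.suc i)) (ℕ.m≤m+n 64 8))
  where
  modulus : ℕ → ℕ
  -- Even for the independence argument, and shifted by one so that it is never 0.
  modulus i = 2 * ℕ.suc i
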